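{- Let $T$ and $B$ be lattice paths with steps $N=(0,1)$ and $E=(1,0)$ from the origin to a point $(x,y)\in\mathbb N^2$, with $T$ weakly above $B$. Then the pairs of statistics $(b,\ell)$ and $(t,r)$ have the same joint distribution over $\mathcal P(T,B)$, i.e. $$\sum_{P\in\mathcal P(T,B)} u^{b(P)}v^{\ell(P)}=\sum_{P\in\mathcal P(T,B)} u^{t(P)}v^{r(P)}.$$
   Context: $T$ weakly above $B$ means no point of $T$ is strictly below or strictly to the right of $B$. $\mathcal P(T,B)$ is the set of lattice paths with steps $N$ and $E$ from the origin to $(x,y)$ lying weakly above $B$ and weakly below $T$. For $P\in\mathcal P(T,B)$: $t(P)$ is the number of top contacts (east steps of $P$ that are also steps of $T$), $b(P)$ the number of bottom contacts (east steps of $P$ that are also steps of $B$), $\ell(P)$ the number of left contacts (north steps of $P$ that are also steps of $T$), and $r(P)$ the number of right contacts (north steps of $P$ that are also steps of $B$). -}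

module Defs where

open import Data.Nat using (ℕ; zero; suc; _+_; _≤_; _≤?_)
open import Data.Nat.Properties using () renaming (_≟_ to _≟ℕ_)
open import Data.Product using (_×_; _,_; proj₁; proj₂)
open import Data.Product.Properties using (≡-dec)
open import Data.List using (List; []; _∷_; map; concatMap; take; length; filter; upTo)
open import Data.List.Relation.Unary.All using (All; all?)
open import Relation.Binary.PropositionalEquality using (_≡_; refl)
open import Relation.Binary.Definitions using (DecidableEquality)
open import Relation.Nullary using (Dec; yes; no; _×-dec_)
open import Relation.Unary using (Decidable)

data Step : Set where
  N E : Step

_≟Step_ : DecidableEquality Step
N ≟Step N = yes refl
N ≟Step E = no (λ ())
E ≟Step N = no (λ ())
E ≟Step E = yes refl

Point : Set
Point = ℕ × ℕ

_≟Pt_ : DecidableEquality Point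
_≟Pt_ = ≡-dec _≟ℕ_ _≟ℕ_

move : Point → Step → Point
move (a , b) N = (a , suc b)
move (a , b) E = (suc a , b)

Path : Set
Path = List Step

endFrom : Point → Path → Point
endFrom p []       = p
endFrom p (s ∷ ss) = endFrom (move p s) ss

endpoint : Path → Point
endpoint = endFrom (0 , 0)

Segment : Set
Segment = Point × Step

_≟Seg_ : DecidableEquality Segment
_≟Seg_ = ≡-dec _≟Pt_ _≟Step_

segmentsFrom : Point → Path → List Segment
segmentsFrom p []       = []
segmentsFrom p (s ∷ ss) = (p , s) ∷ segmentsFrom (move p s) ss

segments : Path → List Segment
segments = segmentsFrom (0 , 0)

countN : Path → ℕ
countN []       = 0
countN (N ∷ ss) = suc (countN ss)
countN (E ∷ ss) = countN ss

-- T weakly above B (both from the origin, same length): after every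
-- k steps, T has made at least as many north steps as B.
WeaklyAbove : Path → Path → Set
WeaklyAbove T B = All (λ k → countN (take k B) ≤ countN (take k T)) (upTo (suc (length T)))

weaklyAbove? : (T B : Path) → Dec (WeaklyAbove T B)
weaklyAbove? T B = all? (λ k → countN (take k B) ≤? countN (take k T)) (upTo (suc (length T)))

words : ℕ → List Path
words zero    = [] ∷ []
words (suc n) = concatMap (λ w → (N ∷ w) ∷ (E ∷ w) ∷ []) (words n)

InPTB : ℕ → ℕ → Path → Path → Path → Set
InPTB x y T B P = (endpoint P ≡ (x , y)) × (WeaklyAbove P B × WeaklyAbove T P)

inPTB? : (x y : ℕ) (T B : Path) → Decidable (InPTB x y T B)
inPTB? x y T B P = (endpoint P ≟Pt (x , y)) ×-dec (weaklyAbove? P B ×-dec weaklyAbove? T P)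

𝒫 : ℕ → ℕ → Path → Path → List Path
𝒫 x y T B = filter (inPTB? x y T B) (words (x + y))

contacts : Step → Path → Path → ℕ
contacts d Q P = length (filter (λ s → (proj₂ s ≟Step d) ×-dec dec∈ s (segments Q)) (segments P))
  where
  open import Data.List.Membership.DecPropositional _≟Seg_ using () renaming (_∈?_ to dec∈)

t b ℓ r : Path → Path → Path → ℕ
t T B P = contacts E T P
b T B P = contacts E B P
ℓ T B P = contacts N T P
r T B P = contacts N B P

jointCount : ℕ → ℕ → Path → Path → (Path → ℕ) → (Path → ℕ) → ℕ → ℕ → ℕ
jointCount x y T B f g i j =
  length (filter (λ P → (f P ≟ℕ i) ×-dec (g P ≟ℕ j)) (𝒫 x y T B))

{-# OPTIONS --safe #-}
-- The statistics (b , ℓ) and (t , r) are the activities of the lattice path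
-- matroid bounded by T and B for the two opposite orders of the steps, so the
-- claim is the order independence of the Tutte polynomial, and its usual
-- deletion–contraction proof applies.  If T and B agree in their first or last
-- step, this step is forced and can be removed.  Otherwise T = N T′ E and
-- B = E B′ N.  Splitting the paths by their first step expresses the (t , r)
-- distribution through two shorter pairs of boundaries (the gap that this step
-- opens is closed by flipping the first E of T or the first N of B), while
-- splitting by the last step does the same for the (b , ℓ) distribution, with
-- last instead of first flips.  By induction on the length both sides equal the
-- same sum over four pairs of boundaries, because the two kinds of flips
-- commute.

module Submission where

open import Defs
open import Data.Nat using (ℕ; zero; suc; _+_; _*_; _≤_; _<_; z≤n; s≤s; s≤s⁻¹; _≡ᵇ_)
open import Data.Nat.Properties
open import Data.Bool using (if_then_else_)
open import Data.Empty using (⊥-elim)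
open import Data.Product using (_×_; _,_; proj₁; proj₂; ∃)
open import Data.List using ([]; _∷_; length; filter; map; concatMap; take)
open import Data.Nat.ListAction using (sum)
open import Data.List.Properties using (filter-accept; filter-reject)
open import Data.List.Membership.DecPropositional _≟Seg_ using ()
  renaming (_∈_ to _∈ₛ_; _∈?_ to _∈ₛ?_)
open import Data.List.Relation.Unary.All as All using (All; []; _∷_)
import Data.List.Relation.Unary.All.Properties as All
import Data.List.Relation.Unary.Any as Any
open import Data.Vec using (Vec; []; _∷_; _∷ʳ_; replicate; toList; fromList; initLast)
open import Data.Vec.Properties using (length-toList; toList∘fromList)
open import Data.Vec.Relation.Unary.Any using (here; there)
open import Data.Vec.Membership.DecPropositional _≟Step_ using (_∈_; _∉_; _∈?_)
open import Function using (_∘_; id)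
open import Relation.Binary.PropositionalEquality
open import Relation.Nullary using (¬_; Dec; does; yes; no; contradiction; _×-dec_)
open import Relation.Unary using (Decidable)
open import Algebra.Properties.CommutativeSemigroup +-commutativeSemigroup using (interchange)

private variable
  a m n : ℕ
  d : Step
  p q : Point

-- Sums over words in the two steps.

opp : Step → Step
opp N = E
opp E = N

∑ : ∀ n → (Vec Step n → ℕ) → ℕ
∑ zero    f = f []
∑ (suc n) f = ∑ n (λ w → f (N ∷ w)) + ∑ n (λ w → f (E ∷ w))

∑-cong : ∀ n {f g : Vec Step n → ℕ} → (∀ w → f w ≡ g w) → ∑ n f ≡ ∑ n g
∑-cong zero    f≗g = f≗g []
∑-cong (suc n) f≗g = cong₂ _+_ (∑-cong n (λ w → f≗g (N ∷ w))) (∑-cong n (λ w → f≗g (E ∷ w)))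

∑-zero : ∀ n {f : Vec Step n → ℕ} → (∀ w → f w ≡ 0) → ∑ n f ≡ 0
∑-zero zero    f≗0 = f≗0 []
∑-zero (suc n) f≗0 = cong₂ _+_ (∑-zero n (λ w → f≗0 (N ∷ w))) (∑-zero n (λ w → f≗0 (E ∷ w)))

∑-∷ʳ : ∀ n (f : Vec Step (suc n) → ℕ) →
  ∑ (suc n) f ≡ ∑ n (λ w → f (w ∷ʳ N)) + ∑ n (λ w → f (w ∷ʳ E))
∑-∷ʳ zero    f = refl
∑-∷ʳ (suc n) f = trans
  (cong₂ _+_ (∑-∷ʳ n (λ w → f (N ∷ w))) (∑-∷ʳ n (λ w → f (E ∷ w))))
  (interchange (∑ n (λ w → f (N ∷ (w ∷ʳ N)))) _ _ _)

-- Contact counts of two paths that run in parallel.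

shift : (ℕ → ℕ) → ℕ → ℕ
shift f zero    = 0
shift f (suc k) = f k

-- Accounts for a step s that both paths take at gap a, where only the
-- d-steps taken at gap 0 are contacts.
tally : Step → Step → ℕ → (ℕ → ℕ) → ℕ → ℕ
tally N N zero f = shift f
tally E E zero f = shift f
tally _ _ _    f = f

-- 1 if L, started a units below U (in height), never rises above U, ends e
-- units below U, and shares exactly k d-steps with U; 0 otherwise.
run : Step → ℕ → ℕ → Vec Step n → Vec Step n → ℕ → ℕ
run d a       e []      []      zero    = if a ≡ᵇ e then 1 else 0
run d a       e []      []      (suc k) = 0
run d a       e (N ∷ U) (N ∷ L) k = tally d N a (run d a e U L) k
run d a       e (E ∷ U) (E ∷ L) k = tally d E a (run d a e U L) k
run d a       e (N ∷ U) (E ∷ L) k = run d (suc a) e U L k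
run d zero    e (E ∷ U) (N ∷ L) k = 0
run d (suc a) e (E ∷ U) (N ∷ L) k = run d a e U L k

shift-cong : ∀ {f g} → (∀ k → f k ≡ g k) → ∀ k → shift f k ≡ shift g k
shift-cong f≗g zero    = refl
shift-cong f≗g (suc k) = f≗g k

tally-cong : ∀ d s a {f g} → (∀ k → f k ≡ g k) → ∀ k → tally d s a f k ≡ tally d s a g k
tally-cong N N zero    = shift-cong
tally-cong N N (suc _) f≗g = f≗g
tally-cong N E _       f≗g = f≗g
tally-cong E N _       f≗g = f≗g
tally-cong E E zero    = shift-cong
tally-cong E E (suc _) f≗g = f≗g

tally-zero : ∀ d s a {f} → (∀ k → f k ≡ 0) → ∀ k → tally d s a f k ≡ 0
tally-zero N N zero    f≗0 zero    = refl
tally-zero N N zero    f≗0 (suc k) = f≗0 k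
tally-zero N N (suc _) f≗0 = f≗0
tally-zero N E _       f≗0 = f≗0
tally-zero E N _       f≗0 = f≗0
tally-zero E E zero    f≗0 zero    = refl
tally-zero E E zero    f≗0 (suc k) = f≗0 k
tally-zero E E (suc _) f≗0 = f≗0

tally-comm : ∀ d s a s′ a′ f k →
  tally d s a (tally d s′ a′ f) k ≡ tally d s′ a′ (tally d s a f) k
tally-comm N N zero    N zero     f k = refl
tally-comm N N zero    N (suc a′) f k = refl
tally-comm N N (suc a) N zero     f k = refl
tally-comm N N (suc a) N (suc a′) f k = refl
tally-comm N N a       E a′       f k = refl
tally-comm N E a       s′ a′      f k = refl
tally-comm E N a       s′ a′      f k = refl
tally-comm E E a       N a′       f k = refl
tally-comm E E zero    E zero     f k = refl
tally-comm E E zero    E (suc a′) f k = refl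
tally-comm E E (suc a) E zero     f k = refl
tally-comm E E (suc a) E (suc a′) f k = refl

-- The effect of the last step on `run`.

run-∷ʳ-EN : ∀ d a e (U L : Vec Step n) k →
  run d a e (U ∷ʳ E) (L ∷ʳ N) k ≡ run d a (suc e) U L k
run-∷ʳ-EN d zero    e []      []      zero    = refl
run-∷ʳ-EN d (suc a) e []      []      zero    = refl
run-∷ʳ-EN d zero    e []      []      (suc k) = refl
run-∷ʳ-EN d (suc a) e []      []      (suc k) = refl
run-∷ʳ-EN d a       e (N ∷ U) (E ∷ L) k = run-∷ʳ-EN d (suc a) e U L k
run-∷ʳ-EN d zero    e (E ∷ U) (N ∷ L) k = refl
run-∷ʳ-EN d (suc a) e (E ∷ U) (N ∷ L) k = run-∷ʳ-EN d a e U L k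
run-∷ʳ-EN d a       e (N ∷ U) (N ∷ L) k = tally-cong d N a (run-∷ʳ-EN d a e U L) k
run-∷ʳ-EN d a       e (E ∷ U) (E ∷ L) k = tally-cong d E a (run-∷ʳ-EN d a e U L) k

-- A last `N` of the upper path over a last `E` of the lower one widens the gap by 1, so the gap
-- cannot end at 0.
run-∷ʳ-NE : ∀ d a (U L : Vec Step n) k → run d a 0 (U ∷ʳ N) (L ∷ʳ E) k ≡ 0
run-∷ʳ-NE d a       []      []      zero    = refl
run-∷ʳ-NE d a       []      []      (suc k) = refl
run-∷ʳ-NE d a       (N ∷ U) (E ∷ L) k = run-∷ʳ-NE d (suc a) U L k
run-∷ʳ-NE d zero    (E ∷ U) (N ∷ L) k = refl
run-∷ʳ-NE d (suc a) (E ∷ U) (N ∷ L) k = run-∷ʳ-NE d a U L k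
run-∷ʳ-NE d a       (N ∷ U) (N ∷ L) k = tally-zero d N a (run-∷ʳ-NE d a U L) k
run-∷ʳ-NE d a       (E ∷ U) (E ∷ L) k = tally-zero d E a (run-∷ʳ-NE d a U L) k

-- The tally is taken at gap 0 whatever `a` is: for positive `a` the paths do not end together, and
-- both sides vanish.
run-[s] : ∀ d a s k → run d a 0 (s ∷ []) (s ∷ []) k ≡ tally d s 0 (run d a 0 [] []) k
run-[s] N zero    N k       = refl
run-[s] N (suc a) N zero    = refl
run-[s] N (suc a) N (suc zero)    = refl
run-[s] N (suc a) N (suc (suc k)) = refl
run-[s] N a       E k       = refl
run-[s] E a       N k       = refl
run-[s] E zero    E k       = refl
run-[s] E (suc a) E zero    = refl
run-[s] E (suc a) E (suc zero)    = refl
run-[s] E (suc a) E (suc (suc k)) = refl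

-- Equal steps keep the gap, so ending at gap 0 puts the common last step at gap 0; `tally-comm`
-- moves its tally in front of the earlier ones.
run-∷ʳ-same : ∀ d a s (U L : Vec Step n) k →
  run d a 0 (U ∷ʳ s) (L ∷ʳ s) k ≡ tally d s 0 (run d a 0 U L) k
run-∷ʳ-same d a       s []      []      k = run-[s] d a s k
run-∷ʳ-same d a       s (N ∷ U) (E ∷ L) k =
  trans (run-∷ʳ-same d (suc a) s U L k) (tally-cong d s 0 (λ _ → refl) k)
run-∷ʳ-same d zero    s (E ∷ U) (N ∷ L) k = sym (tally-zero d s 0 (λ _ → refl) k)
run-∷ʳ-same d (suc a) s (E ∷ U) (N ∷ L) k =
  trans (run-∷ʳ-same d a s U L k) (tally-cong d s 0 (λ _ → refl) k)
run-∷ʳ-same d a       s (N ∷ U) (N ∷ L) k = trans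
  (tally-cong d N a (run-∷ʳ-same d a s U L) k)
  (trans (tally-comm d N a s 0 (run d a 0 U L) k) (tally-cong d s 0 (λ _ → refl) k))
run-∷ʳ-same d a       s (E ∷ U) (E ∷ L) k = trans
  (tally-cong d E a (run-∷ʳ-same d a s U L) k)
  (trans (tally-comm d E a s 0 (run d a 0 U L) k) (tally-cong d s 0 (λ _ → refl) k))

-- Flips that absorb a gap at the start or at the end.

flipFirst : Step → Vec Step n → Vec Step n
flipFirst s []      = []
flipFirst N (N ∷ T) = E ∷ T
flipFirst N (E ∷ T) = E ∷ flipFirst N T
flipFirst E (E ∷ T) = N ∷ T
flipFirst E (N ∷ T) = N ∷ flipFirst E T

-- Flips the head when the tail has no s, whatever the head is: meaningful only if s occurs.
flipLast : Step → Vec Step n → Vec Step n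
flipLast s []      = []
flipLast s (x ∷ T) with s ∈? T
... | yes _ = x ∷ flipLast s T
... | no  _ = opp x ∷ T

flipLast-there : ∀ {s x} {T : Vec Step n} → s ∈ T → flipLast s (x ∷ T) ≡ x ∷ flipLast s T
flipLast-there {s = s} {T = T} s∈T with s ∈? T
... | yes _   = refl
... | no  s∉T = contradiction s∈T s∉T

flipLast-here : ∀ {s x} {T : Vec Step n} → s ∉ T → flipLast s (x ∷ T) ≡ opp x ∷ T
flipLast-here {s = s} {T = T} s∉T with s ∈? T
... | yes s∈T = contradiction s∈T s∉T
... | no  _   = refl

-- Before its first `E` the path `U` only rises, so `L` cannot cross it there, and shared `N` steps
-- are not counted; starting `U` one unit lower changes nothing. At that `E` the original gap is
-- positive, hence no contact; the `N` that replaces it is not counted either and restores the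
-- missing unit. `lower-start` is the mirror image.
raise-start : ∀ a e {U : Vec Step n} → E ∈ U → (L : Vec Step n) → ∀ k →
  run E (suc a) e U L k ≡ run E a e (flipFirst E U) L k
raise-start a e {E ∷ U} _           (N ∷ L) k = refl
raise-start a e {E ∷ U} _           (E ∷ L) k = refl
raise-start a e {N ∷ U} (there E∈U) (N ∷ L) k = raise-start a e E∈U L k
raise-start a e {N ∷ U} (there E∈U) (E ∷ L) k = raise-start (suc a) e E∈U L k

lower-start : ∀ a e {L : Vec Step n} → N ∈ L → (U : Vec Step n) → ∀ k →
  run N (suc a) e U L k ≡ run N a e U (flipFirst N L) k
lower-start a e {N ∷ L} _           (N ∷ U) k = refl
lower-start a e {N ∷ L} _           (E ∷ U) k = refl
lower-start a e {E ∷ L} (there N∈L) (N ∷ U) k = lower-start (suc a) e N∈L U k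
lower-start a e {E ∷ L} (there N∈L) (E ∷ U) k = lower-start a e N∈L U k

-- With no `N` in `U` the gap never grows, so a path ending at gap 1 keeps a gap of at least 1 and
-- still fits when `U` is lowered by one unit; no counted contact can occur. For the same reason gap
-- 1 cannot be reached from gap 0.
drop-top : ∀ a {U : Vec Step n} → N ∉ U → (L : Vec Step n) → ∀ k →
  run N (suc a) 1 U L k ≡ run N a 0 U L k
drop-top-0 : ∀ {U : Vec Step n} → N ∉ U → (L : Vec Step n) → ∀ k → run N 0 1 U L k ≡ 0

drop-top a       {[]}    N∉U []      zero    = refl
drop-top a       {[]}    N∉U []      (suc k) = refl
drop-top a       {N ∷ U} N∉U L       k = contradiction (here refl) N∉U
drop-top zero    {E ∷ U} N∉U (N ∷ L) k = drop-top-0 (N∉U ∘ there) L k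
drop-top (suc a) {E ∷ U} N∉U (N ∷ L) k = drop-top a (N∉U ∘ there) L k
drop-top a       {E ∷ U} N∉U (E ∷ L) k = drop-top a (N∉U ∘ there) L k

drop-top-0 {U = []}    N∉U []      zero    = refl
drop-top-0 {U = []}    N∉U []      (suc k) = refl
drop-top-0 {U = N ∷ U} N∉U L       k = contradiction (here refl) N∉U
drop-top-0 {U = E ∷ U} N∉U (N ∷ L) k = refl
drop-top-0 {U = E ∷ U} N∉U (E ∷ L) k = drop-top-0 (N∉U ∘ there) L k

lift-bottom : ∀ a {L : Vec Step n} → E ∉ L → (U : Vec Step n) → ∀ k →
  run E (suc a) 1 U L k ≡ run E a 0 U L k
lift-bottom-0 : ∀ {L : Vec Step n} → E ∉ L → (U : Vec Step n) → ∀ k → run E 0 1 U L k ≡ 0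

lift-bottom a       {[]}    E∉L []      zero    = refl
lift-bottom a       {[]}    E∉L []      (suc k) = refl
lift-bottom a       {E ∷ L} E∉L U       k = contradiction (here refl) E∉L
lift-bottom zero    {N ∷ L} E∉L (E ∷ U) k = lift-bottom-0 (E∉L ∘ there) U k
lift-bottom (suc a) {N ∷ L} E∉L (E ∷ U) k = lift-bottom a (E∉L ∘ there) U k
lift-bottom a       {N ∷ L} E∉L (N ∷ U) k = lift-bottom a (E∉L ∘ there) U k

lift-bottom-0 {L = []}    E∉L []      zero    = refl
lift-bottom-0 {L = []}    E∉L []      (suc k) = refl
lift-bottom-0 {L = E ∷ L} E∉L U       k = contradiction (here refl) E∉L
lift-bottom-0 {L = N ∷ L} E∉L (E ∷ U) k = refl
lift-bottom-0 {L = N ∷ L} E∉L (N ∷ U) k = lift-bottom-0 (E∉L ∘ there) U k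

-- Up to its last `N` the path `U` is unchanged; behind it only `E` steps follow, and `drop-top`
-- lowers them by one unit. `raise-end` is the mirror image.
lower-end : ∀ a {U : Vec Step n} → N ∈ U → (L : Vec Step n) → ∀ k →
  run N a 1 U L k ≡ run N a 0 (flipLast N U) L k
lower-end a       {x ∷ U} N∈xU        L       k with N ∈? U
lower-end a       {N ∷ U} _           (N ∷ L) k | yes N∈U = tally-cong N N a (lower-end a N∈U L) k
lower-end a       {N ∷ U} _           (E ∷ L) k | yes N∈U = lower-end (suc a) N∈U L k
lower-end zero    {E ∷ U} _           (N ∷ L) k | yes N∈U = refl
lower-end (suc a) {E ∷ U} _           (N ∷ L) k | yes N∈U = lower-end a N∈U L k
lower-end a       {E ∷ U} _           (E ∷ L) k | yes N∈U = lower-end a N∈U L k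
-- Before the flip this step is a contact, but the end gap 1 is out of reach from gap 0; after the
-- flip `L` crosses `U` at once. Both sides are 0.
lower-end zero    {N ∷ U} _           (N ∷ L) k | no  N∉U = tally-zero N N 0 (drop-top-0 N∉U L) k
lower-end (suc a) {N ∷ U} _           (N ∷ L) k | no  N∉U = drop-top a N∉U L k
lower-end a       {N ∷ U} _           (E ∷ L) k | no  N∉U = drop-top a N∉U L k
lower-end a       {E ∷ U} (there N∈U) L       k | no  N∉U = contradiction N∈U N∉U

raise-end : ∀ a {L : Vec Step n} → E ∈ L → (U : Vec Step n) → ∀ k →
  run E a 1 U L k ≡ run E a 0 U (flipLast E L) k
raise-end a       {x ∷ L} E∈xL        U       k with E ∈? L
raise-end a       {E ∷ L} _           (E ∷ U) k | yes E∈L = tally-cong E E a (raise-end a E∈L U) k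
raise-end a       {E ∷ L} _           (N ∷ U) k | yes E∈L = raise-end (suc a) E∈L U k
raise-end zero    {N ∷ L} _           (E ∷ U) k | yes E∈L = refl
raise-end (suc a) {N ∷ L} _           (E ∷ U) k | yes E∈L = raise-end a E∈L U k
raise-end a       {N ∷ L} _           (N ∷ U) k | yes E∈L = raise-end a E∈L U k
raise-end zero    {E ∷ L} _           (E ∷ U) k | no  E∉L = tally-zero E E 0 (lift-bottom-0 E∉L U) k
raise-end (suc a) {E ∷ L} _           (E ∷ U) k | no  E∉L = lift-bottom a E∉L U k
raise-end a       {E ∷ L} _           (N ∷ U) k | no  E∉L = lift-bottom a E∉L U k
raise-end a       {N ∷ L} (there E∈L) U       k | no  E∉L = contradiction E∈L E∉L

-- Counts of paths between two boundaries, and their recursions.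

term : Step → Vec Step n → Vec Step n → ℕ → ℕ → Vec Step n → ℕ
term d T B k l w = run d 0 0 T w k * run (opp d) 0 0 w B l

abstract
  -- The number of paths between T and B with k top contacts of type d and
  -- l bottom contacts of the other type: d = E gives (t , r), d = N gives (ℓ , b).
  W : Step → Vec Step n → Vec Step n → ℕ → ℕ → ℕ
  W {n} d T B k l = ∑ n (term d T B k l)

  -- A path that starts with `N` follows the upper boundary and opens a gap to the lower one, which
  -- `lower-start` closes; a start with `E` is symmetric. For `d = E` neither shared first step is
  -- of a counted type. For `d = N` this is true of the last step instead, whence `W-last`.
  W-first : ∀ {T B : Vec Step n} → E ∈ T → N ∈ B → ∀ k l →
    W E (N ∷ T) (E ∷ B) k l ≡ W E T (flipFirst N B) k l + W E (flipFirst E T) B k l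
  W-first {n} {T} {B} E∈T N∈B k l = cong₂ _+_
    (∑-cong n (λ w → cong (run E 0 0 T w k *_) (lower-start 0 0 N∈B w l)))
    (∑-cong n (λ w → cong (_* run N 0 0 w B l) (raise-start 0 0 E∈T w k)))

  W-last : ∀ {T B : Vec Step n} → N ∈ T → E ∈ B → ∀ k l →
    W N (T ∷ʳ E) (B ∷ʳ N) k l ≡ W N (flipLast N T) B k l + W N T (flipLast E B) k l
  W-last {n} {T} {B} N∈T E∈B k l = trans (∑-∷ʳ n (term N (T ∷ʳ E) (B ∷ʳ N) k l)) (cong₂ _+_
    (∑-cong n (λ w → cong₂ _*_
      (trans (run-∷ʳ-EN N 0 0 T w k) (lower-end 0 N∈T w k))
      (run-∷ʳ-same E 0 N w B l)))
    (∑-cong n (λ w → cong₂ _*_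
      (run-∷ʳ-same N 0 E T w k)
      (trans (run-∷ʳ-EN E 0 0 w B l) (raise-end 0 E∈B w l)))))

  W-EN-zero : ∀ d (T B : Vec Step n) k l → W d (E ∷ T) (N ∷ B) k l ≡ 0
  W-EN-zero {n} d T B k l = cong₂ _+_
    (∑-zero n (λ w → refl)) (∑-zero n (λ w → *-zeroʳ (run d 0 0 (E ∷ T) (E ∷ w) k)))

  -- A last `N` of the path clashes with the final `E` of the lower boundary, a last `E` with the
  -- final `N` of the upper one.
  W-∷ʳNE-zero : ∀ d (T B : Vec Step n) k l → W d (T ∷ʳ N) (B ∷ʳ E) k l ≡ 0
  W-∷ʳNE-zero {n} d T B k l = trans (∑-∷ʳ n (term d (T ∷ʳ N) (B ∷ʳ E) k l)) (cong₂ _+_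
    (∑-zero n (λ w → trans (cong (run d 0 0 (T ∷ʳ N) (w ∷ʳ N) k *_) (run-∷ʳ-NE (opp d) 0 w B l))
                           (*-zeroʳ (run d 0 0 (T ∷ʳ N) (w ∷ʳ N) k))))
    (∑-zero n (λ w → cong (_* run (opp d) 0 0 (w ∷ʳ E) _ l) (run-∷ʳ-NE d 0 T w k))))

  -- The count when both boundaries have a further common step `s` at one end: the path has to take
  -- it too, at gap 0 on both sides. The same formula serves for a first and for a last step.
  W⁺ : Step → Step → Vec Step n → Vec Step n → ℕ → ℕ → ℕ
  W⁺ {n} d s T B k l =
    ∑ n (λ w → tally d s 0 (run d 0 0 T w) k * tally (opp d) s 0 (run (opp d) 0 0 w B) l)

  W-same-∷ : ∀ d s (T B : Vec Step n) k l → W d (s ∷ T) (s ∷ B) k l ≡ W⁺ d s T B k l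
  W-same-∷ {n} d N T B k l = trans
    (cong (W⁺ d N T B k l +_) (∑-zero n (λ w → *-zeroʳ (run d 0 0 (N ∷ T) (E ∷ w) k))))
    (+-identityʳ _)
  W-same-∷ {n} d E T B k l = cong (_+ W⁺ d E T B k l) (∑-zero n (λ w → refl))

  W-same-∷ʳ : ∀ d s (T B : Vec Step n) k l → W d (T ∷ʳ s) (B ∷ʳ s) k l ≡ W⁺ d s T B k l
  W-same-∷ʳ {n} d N T B k l = trans (∑-∷ʳ n (term d (T ∷ʳ N) (B ∷ʳ N) k l)) (trans (cong₂ _+_
    (∑-cong n (λ w → cong₂ _*_ (run-∷ʳ-same d 0 N T w k) (run-∷ʳ-same (opp d) 0 N w B l)))
    (∑-zero n (λ w → cong (_* run (opp d) 0 0 (w ∷ʳ E) _ l) (run-∷ʳ-NE d 0 T w k))))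
    (+-identityʳ _))
  W-same-∷ʳ {n} d E T B k l = trans (∑-∷ʳ n (term d (T ∷ʳ E) (B ∷ʳ E) k l)) (cong₂ _+_
    (∑-zero n (λ w → trans (cong (run d 0 0 (T ∷ʳ E) (w ∷ʳ N) k *_) (run-∷ʳ-NE (opp d) 0 w B l))
                           (*-zeroʳ (run d 0 0 (T ∷ʳ E) (w ∷ʳ N) k))))
    (∑-cong n (λ w → cong₂ _*_ (run-∷ʳ-same d 0 E T w k) (run-∷ʳ-same (opp d) 0 E w B l))))

  -- A forced `N` adds 1 to the first count for `d = N` and to the second for `d = E`, and the
  -- exchange swaps exactly these two. A forced `E` does the same for the other two.
  W⁺-exchange : ∀ s (T B : Vec Step n) → (∀ k l → W N T B k l ≡ W E T B l k) →
    ∀ k l → W⁺ N s T B k l ≡ W⁺ E s T B l k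
  W⁺-exchange {n} N T B W≡ zero    l =
    trans (∑-zero n (λ w → refl)) (sym (∑-zero n (λ w → *-zeroʳ (run E 0 0 T w l))))
  W⁺-exchange     N T B W≡ (suc k) l = W≡ k l
  W⁺-exchange {n} E T B W≡ k zero    =
    trans (∑-zero n (λ w → *-zeroʳ (run N 0 0 T w k))) (sym (∑-zero n (λ w → refl)))
  W⁺-exchange     E T B W≡ k (suc l) = W≡ k l

  W-∑ : ∀ d (T B : Vec Step n) k l → W d T B k l ≡ ∑ n (term d T B k l)
  W-∑ d T B k l = refl

  exchange-[] : ∀ k l → W N [] [] k l ≡ W E [] [] l k
  exchange-[] zero    zero    = refl
  exchange-[] zero    (suc l) = refl
  exchange-[] (suc k) zero    = refl
  exchange-[] (suc k) (suc l) = refl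

-- Numbers of north steps, and how flips interact.

north : Vec Step n → ℕ
north T = countN (toList T)

north-∷ʳ : ∀ (T : Vec Step n) s → north (T ∷ʳ s) ≡ north (s ∷ T)
north-∷ʳ []      s = refl
north-∷ʳ (N ∷ T) N = cong suc (north-∷ʳ T N)
north-∷ʳ (N ∷ T) E = cong suc (north-∷ʳ T E)
north-∷ʳ (E ∷ T) N = north-∷ʳ T N
north-∷ʳ (E ∷ T) E = north-∷ʳ T E

north-flipFirst : ∀ {s} {T : Vec Step n} → s ∈ T → north (s ∷ flipFirst s T) ≡ north (opp s ∷ T)
north-flipFirst {s = N} {N ∷ T} _           = refl
north-flipFirst {s = N} {E ∷ T} (there s∈T) = north-flipFirst s∈T
north-flipFirst {s = E} {E ∷ T} _           = refl
north-flipFirst {s = E} {N ∷ T} (there s∈T) = cong suc (north-flipFirst s∈T)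

north-flipLast : ∀ {s} {T : Vec Step n} → s ∈ T → north (s ∷ flipLast s T) ≡ north (opp s ∷ T)
north-flipLast {s = s} {x ∷ T} s∈xT        with s ∈? T
north-flipLast {s = N} {N ∷ T} _           | yes s∈T = cong suc (north-flipLast s∈T)
north-flipLast {s = N} {E ∷ T} _           | yes s∈T = north-flipLast s∈T
north-flipLast {s = E} {N ∷ T} _           | yes s∈T = cong suc (north-flipLast s∈T)
north-flipLast {s = E} {E ∷ T} _           | yes s∈T = north-flipLast s∈T
north-flipLast {s = s} {x ∷ T} (there s∈T) | no s∉T = contradiction s∈T s∉T
north-flipLast {s = N} {N ∷ T} (here refl) | no _ = refl
north-flipLast {s = E} {E ∷ T} (here refl) | no _ = refl

∉⇒replicate : ∀ s {T : Vec Step n} → s ∉ T → T ≡ replicate n (opp s)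
∉⇒replicate s {[]}    s∉T = refl
∉⇒replicate N {E ∷ T} s∉T = cong (E ∷_) (∉⇒replicate N (s∉T ∘ there))
∉⇒replicate E {N ∷ T} s∉T = cong (N ∷_) (∉⇒replicate E (s∉T ∘ there))
∉⇒replicate N {N ∷ T} s∉T = contradiction (here refl) s∉T
∉⇒replicate E {E ∷ T} s∉T = contradiction (here refl) s∉T

north≤ : (T : Vec Step n) → north T ≤ n
north≤ []      = z≤n
north≤ (N ∷ T) = s≤s (north≤ T)
north≤ (E ∷ T) = m≤n⇒m≤1+n (north≤ T)

N∈⇒0<north : {T : Vec Step n} → N ∈ T → 0 < north T
N∈⇒0<north {T = N ∷ T} _           = s≤s z≤n
N∈⇒0<north {T = E ∷ T} (there N∈T) = N∈⇒0<north N∈T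

E∈⇒north< : {T : Vec Step n} → E ∈ T → north T < n
E∈⇒north< {T = E ∷ T} _           = s≤s (north≤ T)
E∈⇒north< {T = N ∷ T} (there E∈T) = s≤s (E∈⇒north< E∈T)

north-replicate-E : ∀ n → north (replicate n E) ≡ 0
north-replicate-E zero    = refl
north-replicate-E (suc n) = north-replicate-E n

north-replicate-N : ∀ n → north (replicate n N) ≡ n
north-replicate-N zero    = refl
north-replicate-N (suc n) = cong suc (north-replicate-N n)

-- A word without `s` consists of the other step alone, so its number of north steps is extreme, 0
-- or the full length; a word containing `s` cannot attain that extreme.
∈-transfer : ∀ s {T B : Vec Step n} → north T ≡ north B → s ∈ T → s ∈ B
∈-transfer {n} s {T} {B} eq s∈T with s ∈? B
... | yes s∈B = s∈B
∈-transfer {n} N {T} {B} eq s∈T | no s∉B = ⊥-elim (<-irrefl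
  (sym (trans eq (trans (cong north (∉⇒replicate N s∉B)) (north-replicate-E n)))) (N∈⇒0<north s∈T))
∈-transfer {n} E {T} {B} eq s∈T | no s∉B = ⊥-elim (<-irrefl
  (trans eq (trans (cong north (∉⇒replicate E s∉B)) (north-replicate-N n))) (E∈⇒north< s∈T))

flipFirst-∷ʳ : ∀ {s x} {T : Vec Step n} → s ∈ T → flipFirst s (T ∷ʳ x) ≡ flipFirst s T ∷ʳ x
flipFirst-∷ʳ {s = N} {T = N ∷ T} _           = refl
flipFirst-∷ʳ {s = N} {T = E ∷ T} (there s∈T) = cong (E ∷_) (flipFirst-∷ʳ s∈T)
flipFirst-∷ʳ {s = E} {T = E ∷ T} _           = refl
flipFirst-∷ʳ {s = E} {T = N ∷ T} (there s∈T) = cong (N ∷_) (flipFirst-∷ʳ s∈T)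

flipFirst-N-replicate-E : ∀ n → flipFirst N (replicate n E ∷ʳ N) ≡ replicate n E ∷ʳ E
flipFirst-N-replicate-E zero    = refl
flipFirst-N-replicate-E (suc n) = cong (E ∷_) (flipFirst-N-replicate-E n)

flipFirst-E-replicate-N : ∀ n → flipFirst E (replicate n N ∷ʳ E) ≡ replicate n N ∷ʳ N
flipFirst-E-replicate-N zero    = refl
flipFirst-E-replicate-N (suc n) = cong (N ∷_) (flipFirst-E-replicate-N n)

replicate-∷ʳ : ∀ n (s : Step) → replicate n s ∷ʳ s ≡ s ∷ replicate n s
replicate-∷ʳ zero    s = refl
replicate-∷ʳ (suc n) s = cong (s ∷_) (replicate-∷ʳ n s)

flipLast-replicate : ∀ n s → flipLast s (s ∷ replicate n s) ≡ replicate n s ∷ʳ opp s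
flipLast-replicate zero    s = refl
flipLast-replicate (suc n) s = trans (flipLast-there (here refl)) (cong (s ∷_) (flipLast-replicate n s))

∉-replicate-opp : ∀ n s → s ∉ replicate n (opp s)
∉-replicate-opp (suc n) N (there p) = ∉-replicate-opp n N p
∉-replicate-opp (suc n) E (there p) = ∉-replicate-opp n E p

∈-flipFirst : ∀ {s} {T : Vec Step n} → s ∈ T → opp s ∈ flipFirst s T
∈-flipFirst {s = N} {N ∷ T} _           = here refl
∈-flipFirst {s = N} {E ∷ T} (there s∈T) = here refl
∈-flipFirst {s = E} {E ∷ T} _           = here refl
∈-flipFirst {s = E} {N ∷ T} (there s∈T) = here refl

∈-flipLast : ∀ {s} {T : Vec Step n} → s ∈ T → opp s ∈ flipLast s T
∈-flipLast {s = s} {x ∷ T} s∈xT        with s ∈? T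
∈-flipLast {s = s} {x ∷ T} s∈xT        | yes s∈T = there (∈-flipLast s∈T)
∈-flipLast {s = s} {x ∷ T} (here refl) | no  _   = here refl
∈-flipLast {s = s} {x ∷ T} (there s∈T) | no  s∉T = contradiction s∈T s∉T

-- If the first `s` precedes the last `opp s`, neither flip affects the position that the other one
-- finds. Otherwise every `opp s` precedes every `s`, and in either order the second flip undoes the
-- first.
flips-comm : ∀ s {T : Vec Step n} → s ∈ T → opp s ∈ T →
  flipFirst s (flipLast (opp s) T) ≡ flipLast (opp s) (flipFirst s T)
flips-comm N {N ∷ T} _           (there o∈T) =
  trans (cong (flipFirst N) (flipLast-there o∈T)) (sym (flipLast-there o∈T))
flips-comm E {E ∷ T} _           (there o∈T) =
  trans (cong (flipFirst E) (flipLast-there o∈T)) (sym (flipLast-there o∈T))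
flips-comm N {E ∷ T} (there s∈T) _ with E ∈? T
... | yes o∈T = trans (cong (E ∷_) (flips-comm N s∈T o∈T)) (sym (flipLast-there (∈-flipFirst s∈T)))
flips-comm N {E ∷ N ∷ T} (there s∈T) _ | no o∉T =
  sym (trans (flipLast-there (here refl)) (cong (E ∷_) (flipLast-here (o∉T ∘ there))))
flips-comm N {E ∷ E ∷ T} (there s∈T) _ | no o∉T = contradiction (here refl) o∉T
flips-comm E {N ∷ T} (there s∈T) _ with N ∈? T
... | yes o∈T = trans (cong (N ∷_) (flips-comm E s∈T o∈T)) (sym (flipLast-there (∈-flipFirst s∈T)))
flips-comm E {N ∷ E ∷ T} (there s∈T) _ | no o∉T =
  sym (trans (flipLast-there (here refl)) (cong (N ∷_) (flipLast-here (o∉T ∘ there))))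
flips-comm E {N ∷ N ∷ T} (there s∈T) _ | no o∉T = contradiction (here refl) o∉T


∈-∷ʳ : ∀ (T : Vec Step n) s → s ∈ T ∷ʳ s
∈-∷ʳ []      s = here refl
∈-∷ʳ (x ∷ T) s = there (∈-∷ʳ T s)

-- The exchange of the two distributions, by induction on the length.

Exchange : Vec Step n → Vec Step n → Set
Exchange T B = ∀ k l → W N T B k l ≡ W E T B l k

module _ {m : ℕ} (ih₁ : {T B : Vec Step (suc m)} → north T ≡ north B → Exchange T B)
                 (ih₂ : {T B : Vec Step m} → north T ≡ north B → Exchange T B) where

  exchange-by-expansion : ∀ (T B : Vec Step m) →
    (∀ k l → W N (flipLast N (N ∷ T)) (E ∷ B) k l + W N (N ∷ T) (flipLast E (E ∷ B)) k l
           ≡ W E (T ∷ʳ E) (flipFirst N (B ∷ʳ N)) l k + W E (flipFirst E (T ∷ʳ E)) (B ∷ʳ N) l k) →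
    Exchange (N ∷ (T ∷ʳ E)) (E ∷ (B ∷ʳ N))
  exchange-by-expansion T B eq k l =
    trans (W-last {T = N ∷ T} {B = E ∷ B} (here refl) (here refl) k l)
    (trans (eq k l) (sym (W-first (∈-∷ʳ T E) (∈-∷ʳ B N) l k)))

  exchange-all-E : Exchange (N ∷ (replicate m E ∷ʳ E)) (E ∷ (replicate m E ∷ʳ N))
  exchange-all-E = exchange-by-expansion Es Es eq
    where
    Es = replicate m E
    eq : ∀ k l → W N (flipLast N (N ∷ Es)) (E ∷ Es) k l + W N (N ∷ Es) (flipLast E (E ∷ Es)) k l
           ≡ W E (Es ∷ʳ E) (flipFirst N (Es ∷ʳ N)) l k + W E (flipFirst E (Es ∷ʳ E)) (Es ∷ʳ N) l k
    eq k l rewrite flipLast-here {x = N} (∉-replicate-opp m N) | flipLast-replicate m E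
                 | flipFirst-N-replicate-E m | replicate-∷ʳ m E =
      cong₂ _+_ (ih₁ refl k l) (ih₁ (sym (north-∷ʳ Es N)) k l)

  exchange-all-N : Exchange (N ∷ (replicate m N ∷ʳ E)) (E ∷ (replicate m N ∷ʳ N))
  exchange-all-N = exchange-by-expansion Ns Ns eq
    where
    Ns = replicate m N
    eq : ∀ k l → W N (flipLast N (N ∷ Ns)) (E ∷ Ns) k l + W N (N ∷ Ns) (flipLast E (E ∷ Ns)) k l
           ≡ W E (Ns ∷ʳ E) (flipFirst N (Ns ∷ʳ N)) l k + W E (flipFirst E (Ns ∷ʳ E)) (Ns ∷ʳ N) l k
    eq k l rewrite flipLast-here {x = E} (∉-replicate-opp m E) | flipLast-replicate m N
                 | flipFirst-E-replicate-N m | replicate-∷ʳ m N =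
      cong₂ _+_ (ih₁ (north-∷ʳ Ns E) k l) (ih₁ refl k l)

  -- Each side is expanded a second time, at the opposite end. The induction hypotheses switch
  -- between `W N` and `W E` on the way, because `W N` is expanded at the last step and `W E` at the
  -- first.
  exchange-mixed : ∀ {T B : Vec Step m} → north T ≡ north B →
    N ∈ T → E ∈ T → N ∈ B → E ∈ B → Exchange (N ∷ (T ∷ʳ E)) (E ∷ (B ∷ʳ N))
  exchange-mixed {T} {B} T~B N∈T E∈T N∈B E∈B = exchange-by-expansion T B eq
    where
    T↓ = flipLast N T
    T↑ = flipFirst E T
    B↓ = flipFirst N B
    B↑ = flipLast E B

    T↓~ : suc (north T↓) ≡ north T
    T↓~ = north-flipLast N∈T
    T↑~ : north T↑ ≡ suc (north T)
    T↑~ = north-flipFirst E∈T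
    B↓~ : suc (north B↓) ≡ north B
    B↓~ = north-flipFirst N∈B
    B↑~ : north B↑ ≡ suc (north B)
    B↑~ = north-flipLast E∈B
    T↑↓~ : suc (north (flipLast N T↑)) ≡ suc (north T)
    T↑↓~ = trans (north-flipLast (∈-flipFirst E∈T)) T↑~
    B↓↑~ : north (flipLast E B↓) ≡ north B
    B↓↑~ = trans (north-flipLast (∈-flipFirst N∈B)) B↓~

    open ≡-Reasoning
    eq : ∀ k l → _
    eq k l = begin
      W N (flipLast N (N ∷ T)) (E ∷ B) k l + W N (N ∷ T) (flipLast E (E ∷ B)) k l
        ≡⟨ cong₂ (λ T′ B′ → W N T′ (E ∷ B) k l + W N (N ∷ T) B′ k l)
             (flipLast-there N∈T) (flipLast-there E∈B) ⟩
      W N (N ∷ T↓) (E ∷ B) k l + W N (N ∷ T) (E ∷ B↑) k l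
        ≡⟨ cong₂ _+_ (ih₁ (trans T↓~ T~B) k l) (ih₁ (trans (cong suc T~B) (sym B↑~)) k l) ⟩
      W E (N ∷ T↓) (E ∷ B) l k + W E (N ∷ T) (E ∷ B↑) l k
        ≡⟨ cong₂ _+_ (W-first (∈-flipLast N∈T) N∈B l k) (W-first E∈T (∈-flipLast E∈B) l k) ⟩
      (W E T↓ B↓ l k + W E (flipFirst E T↓) B l k) + (W E T (flipFirst N B↑) l k + W E T↑ B↑ l k)
        -- So far the terms are grouped by the choice of the last step; from here on by the choice
        -- of the first.
        ≡⟨ interchange (W E T↓ B↓ l k) _ _ _ ⟩
      (W E T↓ B↓ l k + W E T (flipFirst N B↑) l k) + (W E (flipFirst E T↓) B l k + W E T↑ B↑ l k)
        ≡⟨ cong₂ (λ T′ B′ → (W E T↓ B↓ l k + W E T B′ l k) + (W E T′ B l k + W E T↑ B↑ l k))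
             (flips-comm E E∈T N∈T) (flips-comm N N∈B E∈B) ⟩
      (W E T↓ B↓ l k + W E T (flipLast E B↓) l k) + (W E (flipLast N T↑) B l k + W E T↑ B↑ l k)
        -- Each group is the outcome of a last-step expansion, which is available for `W N`; hence
        -- the return to `W N` by `ih₂`.
        ≡⟨ cong₂ _+_
             (cong₂ _+_ (ih₂ (suc-injective (trans T↓~ (trans T~B (sym B↓~)))) k l)
                        (ih₂ (trans T~B (sym B↓↑~)) k l))
             (cong₂ _+_ (ih₂ (trans (suc-injective T↑↓~) T~B) k l)
                        (ih₂ (trans T↑~ (trans (cong suc T~B) (sym B↑~))) k l)) ⟨
      (W N T↓ B↓ k l + W N T (flipLast E B↓) k l) + (W N (flipLast N T↑) B k l + W N T↑ B↑ k l)
        ≡⟨ cong₂ _+_ (W-last N∈T (∈-flipFirst N∈B) k l) (W-last (∈-flipFirst E∈T) E∈B k l) ⟨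
      W N (T ∷ʳ E) (B↓ ∷ʳ N) k l + W N (T↑ ∷ʳ E) (B ∷ʳ N) k l
        ≡⟨ cong₂ _+_
             (ih₁ (trans (north-∷ʳ T E) (trans T~B (trans (sym B↓~) (sym (north-∷ʳ B↓ N))))) k l)
             (ih₁ (trans (north-∷ʳ T↑ E) (trans T↑~ (trans (cong suc T~B) (sym (north-∷ʳ B N))))) k l) ⟩
      W E (T ∷ʳ E) (B↓ ∷ʳ N) l k + W E (T↑ ∷ʳ E) (B ∷ʳ N) l k
        ≡⟨ cong₂ (λ B′ T′ → W E (T ∷ʳ E) B′ l k + W E T′ (B ∷ʳ N) l k)
             (flipFirst-∷ʳ N∈B) (flipFirst-∷ʳ E∈T) ⟨
      W E (T ∷ʳ E) (flipFirst N (B ∷ʳ N)) l k + W E (flipFirst E (T ∷ʳ E)) (B ∷ʳ N) l k ∎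

  exchange-NE : (T B : Vec Step m) → north T ≡ north B → Exchange (N ∷ (T ∷ʳ E)) (E ∷ (B ∷ʳ N))
  exchange-NE T B T~B with N ∈? T | E ∈? T
  ... | no N∉T | _ = subst₂ (λ T′ B′ → Exchange (N ∷ (T′ ∷ʳ E)) (E ∷ (B′ ∷ʳ N)))
    (sym (∉⇒replicate N N∉T)) (sym (∉⇒replicate N (N∉T ∘ ∈-transfer N (sym T~B)))) exchange-all-E
  ... | yes _ | no E∉T = subst₂ (λ T′ B′ → Exchange (N ∷ (T′ ∷ʳ E)) (E ∷ (B′ ∷ʳ N)))
    (sym (∉⇒replicate E E∉T)) (sym (∉⇒replicate E (E∉T ∘ ∈-transfer E (sym T~B)))) exchange-all-N
  ... | yes N∈T | yes E∈T =
    exchange-mixed T~B N∈T E∈T (∈-transfer N T~B N∈T) (∈-transfer E T~B E∈T)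

  -- The last steps decide: `N` over `E` leaves no path, a common last step is forced, and `E` over
  -- `N` is the case for expansion.
  exchange-N-E : ∀ {T B : Vec Step (suc m)} → north (N ∷ T) ≡ north (E ∷ B) →
    Exchange (N ∷ T) (E ∷ B)
  exchange-N-E {T} {B} T~B k l with initLast T | initLast B
  ... | T′ , N , refl | B′ , E , refl =
    trans (W-∷ʳNE-zero N (N ∷ T′) (E ∷ B′) k l) (sym (W-∷ʳNE-zero E (N ∷ T′) (E ∷ B′) l k))
  ... | T′ , N , refl | B′ , N , refl = trans (W-same-∷ʳ N N (N ∷ T′) (E ∷ B′) k l)
    (trans (W⁺-exchange N (N ∷ T′) (E ∷ B′) (ih₁ NT′~EB′) k l)
      (sym (W-same-∷ʳ E N (N ∷ T′) (E ∷ B′) l k)))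
    where
    NT′~EB′ : north (N ∷ T′) ≡ north (E ∷ B′)
    NT′~EB′ = trans (sym (north-∷ʳ T′ N)) (suc-injective (trans T~B (north-∷ʳ B′ N)))
  ... | T′ , E , refl | B′ , E , refl = trans (W-same-∷ʳ N E (N ∷ T′) (E ∷ B′) k l)
    (trans (W⁺-exchange E (N ∷ T′) (E ∷ B′) (ih₁ NT′~EB′) k l)
      (sym (W-same-∷ʳ E E (N ∷ T′) (E ∷ B′) l k)))
    where
    NT′~EB′ : north (N ∷ T′) ≡ north (E ∷ B′)
    NT′~EB′ = trans (cong suc (sym (north-∷ʳ T′ E))) (trans T~B (north-∷ʳ B′ E))
  ... | T′ , E , refl | B′ , N , refl = exchange-NE T′ B′
    (suc-injective (trans (cong suc (sym (north-∷ʳ T′ E))) (trans T~B (north-∷ʳ B′ N)))) k l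

exchange : ∀ n {T B : Vec Step n} → north T ≡ north B → Exchange T B
exchange zero {[]} {[]} T~B k l = exchange-[] k l
exchange (suc n) {N ∷ T} {N ∷ B} T~B k l = trans (W-same-∷ N N T B k l)
  (trans (W⁺-exchange N T B (exchange n (suc-injective T~B)) k l) (sym (W-same-∷ E N T B l k)))
exchange (suc n) {E ∷ T} {E ∷ B} T~B k l = trans (W-same-∷ N E T B k l)
  (trans (W⁺-exchange E T B (exchange n T~B) k l) (sym (W-same-∷ E E T B l k)))
exchange (suc n) {E ∷ T} {N ∷ B} T~B k l = trans (W-EN-zero N T B k l) (sym (W-EN-zero E T B l k))
exchange (suc zero) {N ∷ []} {E ∷ []} ()
-- The double expansion removes a step at each end, so both preceding lengths are needed.
exchange (suc (suc n)) {N ∷ T} {E ∷ B} T~B = exchange-N-E (exchange (suc n)) (exchange n) T~B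

-- From filtered lists to sums of zero-one values.

data Indicator (A : Set) : ℕ → Set where
  holds : A → Indicator A 1
  fails : ¬ A → Indicator A 0

Indicator-map : ∀ {A B : Set} {m} → (A → B) → (B → A) → Indicator A m → Indicator B m
Indicator-map f g (holds a) = holds (f a)
Indicator-map f g (fails ¬a) = fails (¬a ∘ g)

Indicator-× : ∀ {A B : Set} {m n} → Indicator A m → Indicator B n → Indicator (A × B) (m * n)
Indicator-× (holds a)  (holds b)  = holds (a , b)
Indicator-× (holds a)  (fails ¬b) = fails (¬b ∘ proj₂)
Indicator-× (fails ¬a) _          = fails (¬a ∘ proj₁)

Indicator⇒if : ∀ {A : Set} {m} (a? : Dec A) → Indicator A m → (if does a? then 1 else 0) ≡ m
Indicator⇒if (yes a) (holds _)  = refl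
Indicator⇒if (yes a) (fails ¬a) = contradiction a ¬a
Indicator⇒if (no ¬a) (holds a)  = contradiction a ¬a
Indicator⇒if (no ¬a) (fails _)  = refl

module _ {Q R : Path → Set} (Q? : Decidable Q) (R? : Decidable R) where

  private
    ind : Path → ℕ
    ind P = if does (R? P ×-dec Q? P) then 1 else 0

  length-filter-filter : ∀ Ps → length (filter Q? (filter R? Ps)) ≡ sum (map ind Ps)
  length-filter-filter [] = refl
  length-filter-filter (P ∷ Ps) with R? P
  ... | no _ = length-filter-filter Ps
  ... | yes _ with Q? P
  ...   | no  _ = length-filter-filter Ps
  ...   | yes _ = cong suc (length-filter-filter Ps)

  sum-words : ∀ n (f : Path → ℕ) → sum (map f (words n)) ≡ ∑ n (f ∘ toList)
  sum-words zero    f = +-identityʳ (f [])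
  sum-words (suc n) f = trans (split (words n))
    (cong₂ _+_ (sum-words n (f ∘ (N ∷_))) (sum-words n (f ∘ (E ∷_))))
    where
    -- `words` interleaves the extensions by `N` and by `E`, while `∑` keeps them apart.
    split : ∀ Ps → sum (map f (concatMap (λ w → (N ∷ w) ∷ (E ∷ w) ∷ []) Ps))
                 ≡ sum (map (f ∘ (N ∷_)) Ps) + sum (map (f ∘ (E ∷_)) Ps)
    split []       = refl
    split (P ∷ Ps) = trans (sym (+-assoc (f (N ∷ P)) _ _))
      (trans (cong (f (N ∷ P) + f (E ∷ P) +_) (split Ps))
        (interchange (f (N ∷ P)) _ _ _))

  count-words : ∀ n {F : Vec Step n → ℕ} →
    (∀ w → Indicator (R (toList w) × Q (toList w)) (F w)) →
    length (filter Q? (filter R? (words n))) ≡ ∑ n F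
  count-words n F-ind = trans (length-filter-filter (words n)) (trans (sum-words n ind)
    (∑-cong n (λ w → Indicator⇒if (R? (toList w) ×-dec Q? (toList w)) (F-ind w))))

-- Contacts as coincidences at equal times.

level : Point → ℕ
level (a , b) = a + b

level-move : ∀ p s → level (move p s) ≡ suc (level p)
level-move (a , b) N = +-suc a b
level-move (a , b) E = refl

level-segments : ∀ p P → All (λ s → level p ≤ level (proj₁ s)) (segmentsFrom p P)
level-segments p []      = []
level-segments p (s ∷ P) = ≤-refl ∷
  All.map (≤-trans (≤-trans (n≤1+n _) (≤-reflexive (sym (level-move p s))))) (level-segments (move p s) P)

Contact : Step → Point → Path → Segment → Set
Contact d q Q s = proj₂ s ≡ d × s ∈ₛ segmentsFrom q Q

contact? : ∀ d q Q → Decidable (Contact d q Q)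
contact? d q Q s = (proj₂ s ≟Step d) ×-dec (s ∈ₛ? segmentsFrom q Q)

length-filter-cong : ∀ {A : Set} {P Q : A → Set} (P? : Decidable P) (Q? : Decidable Q) {xs} →
  All (λ x → (P x → Q x) × (Q x → P x)) xs → length (filter P? xs) ≡ length (filter Q? xs)
length-filter-cong P? Q? [] = refl
length-filter-cong P? Q? {x ∷ xs} ((p⇒q , q⇒p) ∷ eqs) with P? x | Q? x
... | yes _ | yes _ = cong suc (length-filter-cong P? Q? eqs)
... | yes p | no ¬q = contradiction (p⇒q p) ¬q
... | no ¬p | yes q = contradiction (q⇒p q) ¬p
... | no _  | no _  = length-filter-cong P? Q? eqs

abstract

  contactsFrom : Step → Point → Point → Path → Path → ℕ
  contactsFrom d q p Q P = length (filter (contact? d q Q) (segmentsFrom p P))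

  contacts≡contactsFrom : ∀ d Q P → contacts d Q P ≡ contactsFrom d (0 , 0) (0 , 0) Q P
  contacts≡contactsFrom d Q P = refl

  contactsFrom-[] : ∀ d q p → contactsFrom d q p [] [] ≡ 0
  contactsFrom-[] d q p = refl

  -- `level` counts the steps made since the origin. The head segment of the one path therefore lies
  -- at a lower level than all later segments of the other and cannot equal any of them. This turns
  -- membership in a list into comparison position by position.
  length-filter-tail : ∀ {d q p t s} → level q ≡ level p → ∀ Q P →
    length (filter (contact? d q (t ∷ Q)) (segmentsFrom (move p s) P))
      ≡ contactsFrom d (move q t) (move p s) Q P
  length-filter-tail {d} {q} {p} {t} {s} level≡ Q P =
    length-filter-cong (contact? d q (t ∷ Q)) (contact? d (move q t) Q) (All.map
      (λ p<x → (λ { (x≡d , Any.here refl) → contradiction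
                      (≤-trans (≤-reflexive (trans (cong suc level≡) (sym (level-move p s)))) p<x) (<-irrefl refl)
                  ; (x≡d , Any.there x∈Q) → x≡d , x∈Q })
             , λ (x≡d , x∈Q) → x≡d , Any.there x∈Q)
      (level-segments (move p s) P))

  contactsFrom-hit : ∀ {d q p t s} → level q ≡ level p → ∀ Q P → (q , t) ≡ (p , s) → t ≡ d →
    contactsFrom d q p (t ∷ Q) (s ∷ P) ≡ suc (contactsFrom d (move q t) (move p s) Q P)
  contactsFrom-hit {d} {q} {t = t} level≡ Q P eq t≡d = trans
    (cong length (filter-accept (contact? d q (t ∷ Q)) (trans (sym (cong proj₂ eq)) t≡d , Any.here (sym eq))))
    (cong suc (length-filter-tail level≡ Q P))

  contactsFrom-miss : ∀ {d q p t s} → level q ≡ level p → ∀ Q P → ¬ ((q , t) ≡ (p , s) × t ≡ d) →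
    contactsFrom d q p (t ∷ Q) (s ∷ P) ≡ contactsFrom d (move q t) (move p s) Q P
  contactsFrom-miss {d} {q} {t = t} level≡ Q P ¬hit =
    trans (cong length (filter-reject (contact? d q (t ∷ Q)) λ
      { (s≡d , Any.here eq) → ¬hit (sym eq , trans (sym (cong proj₂ eq)) s≡d)
      ; (s≡d , Any.there p∈Q) → <-irrefl refl
          (≤-trans (≤-reflexive (trans (cong suc (sym level≡)) (sym (level-move q t))))
            (All.lookup (level-segments (move q t) Q) p∈Q)) }))
      (length-filter-tail level≡ Q P)

level-moves : ∀ {q p} t s → level q ≡ level p → level (move q t) ≡ level (move p s)
level-moves {q} {p} t s level≡ = trans (level-move q t) (trans (cong suc level≡) (sym (level-move p s)))

-- Coincidence at equal positions is symmetric. This serves the bottom contacts: `contacts` looks up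
-- steps of the path in `B`, whereas `run` has the path as its upper argument.
contactsFrom-comm : ∀ d {q p} → level q ≡ level p → (Q P : Vec Step n) →
  contactsFrom d q p (toList Q) (toList P) ≡ contactsFrom d p q (toList P) (toList Q)
contactsFrom-comm d {q} {p} level≡ [] [] = trans (contactsFrom-[] d q p) (sym (contactsFrom-[] d p q))
contactsFrom-comm d {q} {p} level≡ (t ∷ Q) (s ∷ P) with ((q , t) ≟Seg (p , s)) ×-dec (t ≟Step d)
... | yes (eq , t≡d) = trans (contactsFrom-hit level≡ (toList Q) (toList P) eq t≡d)
  (trans (cong suc (contactsFrom-comm d (level-moves t s level≡) Q P))
    (sym (contactsFrom-hit (sym level≡) (toList P) (toList Q) (sym eq) (trans (sym (cong proj₂ eq)) t≡d))))
... | no ¬hit = trans (contactsFrom-miss level≡ (toList Q) (toList P) ¬hit)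
  (trans (contactsFrom-comm d (level-moves t s level≡) Q P)
    (sym (contactsFrom-miss (sym level≡) (toList P) (toList Q)
      (λ (eq , s≡d) → ¬hit (sym eq , trans (sym (cong proj₂ eq)) s≡d)))))

-- `run` as the indicator of weak order and contact number.

-- U, started a units above L (in height), stays weakly above L and ends at the same height.
Bounds : ℕ → Vec Step n → Vec Step n → Set
Bounds {n} a U L =
  (∀ k → k ≤ n → countN (take k (toList L)) ≤ a + countN (take k (toList U))) ×
  countN (toList L) ≡ a + countN (toList U)

module _ {n a : ℕ} (U L : Vec Step n) where

  Bounds-NN⁺ : Bounds a U L → Bounds a (N ∷ U) (N ∷ L)
  Bounds-NN⁺ (below , end) =
    (λ { zero _ → z≤n
       ; (suc k) (s≤s k≤n) → ≤-trans (s≤s (below k k≤n)) (≤-reflexive (sym (+-suc a _))) }) ,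
    trans (cong suc end) (sym (+-suc a _))

  Bounds-NN⁻ : Bounds a (N ∷ U) (N ∷ L) → Bounds a U L
  Bounds-NN⁻ (below , end) =
    (λ k k≤n → s≤s⁻¹ (≤-trans (below (suc k) (s≤s k≤n)) (≤-reflexive (+-suc a _)))) ,
    suc-injective (trans end (+-suc a _))

  Bounds-EE⁺ : Bounds a U L → Bounds a (E ∷ U) (E ∷ L)
  Bounds-EE⁺ (below , end) = (λ { zero _ → z≤n ; (suc k) (s≤s k≤n) → below k k≤n }) , end

  Bounds-EE⁻ : Bounds a (E ∷ U) (E ∷ L) → Bounds a U L
  Bounds-EE⁻ (below , end) = (λ k k≤n → below (suc k) (s≤s k≤n)) , end

  Bounds-NE⁺ : Bounds (suc a) U L → Bounds a (N ∷ U) (E ∷ L)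
  Bounds-NE⁺ (below , end) =
    (λ { zero _ → z≤n
       ; (suc k) (s≤s k≤n) → ≤-trans (below k k≤n) (≤-reflexive (sym (+-suc a _))) }) ,
    trans end (sym (+-suc a _))

  Bounds-NE⁻ : Bounds a (N ∷ U) (E ∷ L) → Bounds (suc a) U L
  Bounds-NE⁻ (below , end) =
    (λ k k≤n → ≤-trans (below (suc k) (s≤s k≤n)) (≤-reflexive (+-suc a _))) ,
    trans end (+-suc a _)

  Bounds-EN⁺ : Bounds a U L → Bounds (suc a) (E ∷ U) (N ∷ L)
  Bounds-EN⁺ (below , end) =
    (λ { zero _ → z≤n ; (suc k) (s≤s k≤n) → s≤s (below k k≤n) }) , cong suc end

  Bounds-EN⁻ : Bounds (suc a) (E ∷ U) (N ∷ L) → Bounds a U L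
  Bounds-EN⁻ (below , end) = (λ k k≤n → s≤s⁻¹ (below (suc k) (s≤s k≤n))) , suc-injective end

¬Bounds-0-EN : ∀ (U L : Vec Step n) → ¬ Bounds 0 (E ∷ U) (N ∷ L)
¬Bounds-0-EN U L (below , _) with below 1 (s≤s z≤n)
... | ()

RunOf : Step → ℕ → Point → Point → Vec Step n → Vec Step n → ℕ → Set
RunOf d a q p U L k = Bounds a U L × contactsFrom d q p (toList U) (toList L) ≡ k

Indicator-miss : ∀ {a′} t s {U L : Vec Step n} {k} → level q ≡ level p →
  ¬ ((q , t) ≡ (p , s) × t ≡ d) →
  (Bounds a U L → Bounds a′ (t ∷ U) (s ∷ L)) → (Bounds a′ (t ∷ U) (s ∷ L) → Bounds a U L) →
  Indicator (RunOf d a (move q t) (move p s) U L k) m →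
  Indicator (RunOf d a′ q p (t ∷ U) (s ∷ L) k) m
Indicator-miss t s {U} {L} level≡ ¬hit to from = Indicator-map
  (λ (bnd , eq) → to bnd , trans (contactsFrom-miss level≡ (toList U) (toList L) ¬hit) eq)
  (λ (bnd , eq) → from bnd , trans (sym (contactsFrom-miss level≡ (toList U) (toList L) ¬hit)) eq)

Indicator-hit : ∀ {U L : Vec Step n} {f : ℕ → ℕ} →
  (Bounds 0 U L → Bounds 0 (d ∷ U) (d ∷ L)) → (Bounds 0 (d ∷ U) (d ∷ L) → Bounds 0 U L) →
  (∀ k → Indicator (RunOf d 0 (move q d) (move q d) U L k) (f k)) →
  ∀ k → Indicator (RunOf d 0 q q (d ∷ U) (d ∷ L) k) (shift f k)
Indicator-hit {U = U} {L} to from ih zero = fails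
  (λ (_ , eq) → contradiction (trans (sym (contactsFrom-hit refl (toList U) (toList L) refl refl)) eq) (λ ()))
Indicator-hit {U = U} {L} to from ih (suc k) = Indicator-map
  (λ (bnd , eq) → to bnd , trans (contactsFrom-hit refl (toList U) (toList L) refl refl) (cong suc eq))
  (λ (bnd , eq) → from bnd , suc-injective (trans (sym (contactsFrom-hit refl (toList U) (toList L) refl refl)) eq))
  (ih k)

level-height-injective : level q ≡ level p → proj₂ q ≡ proj₂ p → q ≡ p
level-height-injective {q₁ , q₂} {p₁ , .q₂} level≡ refl = cong (_, q₂) (+-cancelʳ-≡ q₂ q₁ p₁ level≡)

gap-NN : ∀ a {x y} → x ≡ a + y → suc x ≡ a + suc y
gap-NN a eq = trans (cong suc eq) (sym (+-suc a _))

apart : ∀ {q p : Point} {t s : Step} → proj₂ q ≡ suc a + proj₂ p → (q , t) ≢ (p , s)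
apart gap refl = m≢1+n+m _ gap

-- The invariant is that `q` and `p` have equal level and heights differing by `a`. A shared segment
-- is thus possible only at gap 0, where the points coincide; this is the rule built into `tally`.
run-indicator : ∀ d a {q p} → level q ≡ level p → proj₂ q ≡ a + proj₂ p → (U L : Vec Step n) →
  ∀ k → Indicator (RunOf d a q p U L k) (run d a 0 U L k)
run-indicator d zero    {q} {p} level≡ gap [] [] zero =
  holds (((λ { zero _ → z≤n }) , refl) , contactsFrom-[] d q p)
run-indicator d (suc a) level≡ gap [] [] zero    = fails (λ { ((_ , ()) , _) })
run-indicator d a {q} {p} level≡ gap [] [] (suc k) =
  fails (λ (_ , eq) → contradiction (trans (sym (contactsFrom-[] d q p)) eq) (λ ()))
run-indicator d a {q} {p} level≡ gap (N ∷ U) (E ∷ L) k =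
  Indicator-miss N E level≡ (λ { (() , _) }) (Bounds-NE⁺ U L) (Bounds-NE⁻ U L)
    (run-indicator d (suc a) (level-moves {q} {p} N E level≡) (cong suc gap) U L k)
run-indicator d zero    level≡ gap (E ∷ U) (N ∷ L) k = fails (¬Bounds-0-EN U L ∘ proj₁)
run-indicator d (suc a) {q} {p} level≡ gap (E ∷ U) (N ∷ L) k =
  Indicator-miss E N level≡ (λ { (() , _) }) (Bounds-EN⁺ U L) (Bounds-EN⁻ U L)
    (run-indicator d a (level-moves {q} {p} E N level≡) (trans gap (sym (+-suc a _))) U L k)
run-indicator N zero {q} {p} level≡ gap (N ∷ U) (N ∷ L) k with level-height-injective {q} {p} level≡ gap
... | refl = Indicator-hit (Bounds-NN⁺ U L) (Bounds-NN⁻ U L) (run-indicator N 0 refl refl U L) k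
run-indicator N (suc a) {q} {p} level≡ gap (N ∷ U) (N ∷ L) k =
  Indicator-miss N N level≡ (apart gap ∘ proj₁) (Bounds-NN⁺ U L) (Bounds-NN⁻ U L)
    (run-indicator N (suc a) (level-moves {q} {p} N N level≡) (gap-NN (suc a) gap) U L k)
run-indicator E a {q} {p} level≡ gap (N ∷ U) (N ∷ L) k =
  Indicator-miss N N level≡ (λ { (_ , ()) }) (Bounds-NN⁺ U L) (Bounds-NN⁻ U L)
    (run-indicator E a (level-moves {q} {p} N N level≡) (gap-NN a gap) U L k)
run-indicator E zero {q} {p} level≡ gap (E ∷ U) (E ∷ L) k with level-height-injective {q} {p} level≡ gap
... | refl = Indicator-hit (Bounds-EE⁺ U L) (Bounds-EE⁻ U L) (run-indicator E 0 refl refl U L) k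
run-indicator E (suc a) {q} {p} level≡ gap (E ∷ U) (E ∷ L) k =
  Indicator-miss E E level≡ (apart gap ∘ proj₁) (Bounds-EE⁺ U L) (Bounds-EE⁻ U L)
    (run-indicator E (suc a) (cong suc level≡) gap U L k)
run-indicator N a {q} {p} level≡ gap (E ∷ U) (E ∷ L) k =
  Indicator-miss E E level≡ (λ { (_ , ()) }) (Bounds-EE⁺ U L) (Bounds-EE⁻ U L)
    (run-indicator N a (cong suc level≡) gap U L k)

-- Endpoints and weak order expressed by `Bounds`.

Bounds⇒WeaklyAbove : ∀ (U L : Vec Step n) → Bounds 0 U L → WeaklyAbove (toList U) (toList L)
Bounds⇒WeaklyAbove U L (below , _) = All.applyUpTo⁺₁ id _
  (λ k<1+n → below _ (≤-trans (s≤s⁻¹ k<1+n) (≤-reflexive (length-toList U))))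

WeaklyAbove⇒Bounds : ∀ (U L : Vec Step n) → WeaklyAbove (toList U) (toList L) →
  north L ≡ north U → Bounds 0 U L
WeaklyAbove⇒Bounds U L above end =
  (λ k k≤n → All.applyUpTo⁻ id _ above (s≤s (≤-trans k≤n (≤-reflexive (sym (length-toList U)))))) , end

level-endFrom : ∀ p P → level (endFrom p P) ≡ level p + length P
level-endFrom p []      = sym (+-identityʳ _)
level-endFrom p (s ∷ P) = trans (level-endFrom (move p s) P)
  (trans (cong (_+ length P) (level-move p s)) (sym (+-suc _ _)))

height-endFrom : ∀ p P → proj₂ (endFrom p P) ≡ proj₂ p + countN P
height-endFrom p []      = sym (+-identityʳ _)
height-endFrom p (N ∷ P) = trans (height-endFrom (move p N) P) (sym (+-suc _ _))
height-endFrom p (E ∷ P) = height-endFrom (move p E) P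

endpoint⇒length : ∀ {x y} P → endpoint P ≡ (x , y) → length P ≡ x + y
endpoint⇒length P end = trans (sym (level-endFrom (0 , 0) P)) (cong level end)

endpoint⇒countN : ∀ {x y} P → endpoint P ≡ (x , y) → countN P ≡ y
endpoint⇒countN P end = trans (sym (height-endFrom (0 , 0) P)) (cong proj₂ end)

length-countN⇒endpoint : ∀ {x y} P → length P ≡ x + y → countN P ≡ y → endpoint P ≡ (x , y)
length-countN⇒endpoint P len height = level-height-injective
  (trans (level-endFrom (0 , 0) P) len) (trans (height-endFrom (0 , 0) P) height)

-- Equality of the joint distributions.

module _ {x y : ℕ} {T B : Vec Step (x + y)}
  (T-end : endpoint (toList T) ≡ (x , y)) (B-end : endpoint (toList B) ≡ (x , y)) where

  term-indicator : ∀ d k l (w : Vec Step (x + y)) → Indicator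
    (InPTB x y (toList T) (toList B) (toList w) ×
     (contacts d (toList T) (toList w) ≡ k × contacts (opp d) (toList B) (toList w) ≡ l))
    (term d T B k l w)
  term-indicator d k l w = Indicator-map
    (λ ((T≥w , top) , (w≥B , bottom)) →
      ( length-countN⇒endpoint (toList w) (length-toList w) (trans (proj₂ T≥w) T-height)
      , Bounds⇒WeaklyAbove w B w≥B , Bounds⇒WeaklyAbove T w T≥w)
      , trans (contacts≡contactsFrom d (toList T) (toList w)) top
      , trans (trans (contacts≡contactsFrom (opp d) (toList B) (toList w)) (sym (w~B (opp d)))) bottom)
    (λ ((w-end , w≥B , T≥w) , top , bottom) →
      let w-height = endpoint⇒countN (toList w) w-end in
      ( WeaklyAbove⇒Bounds T w T≥w (trans w-height (sym T-height))
      , trans (sym (contacts≡contactsFrom d (toList T) (toList w))) top)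
      , ( WeaklyAbove⇒Bounds w B w≥B (trans B-height (sym w-height))
        , trans (trans (w~B (opp d)) (sym (contacts≡contactsFrom (opp d) (toList B) (toList w)))) bottom))
    (Indicator-× (run-indicator d 0 refl refl T w k) (run-indicator (opp d) 0 refl refl w B l))
    where
    T-height : north T ≡ y
    T-height = endpoint⇒countN (toList T) T-end
    B-height : north B ≡ y
    B-height = endpoint⇒countN (toList B) B-end
    w~B : ∀ d → contactsFrom d (0 , 0) (0 , 0) (toList w) (toList B)
              ≡ contactsFrom d (0 , 0) (0 , 0) (toList B) (toList w)
    w~B d = contactsFrom-comm d refl w B

  jointCount-symmetry : ∀ i j →
    jointCount x y (toList T) (toList B) (b (toList T) (toList B)) (ℓ (toList T) (toList B)) i j ≡
    jointCount x y (toList T) (toList B) (t (toList T) (toList B)) (r (toList T) (toList B)) i j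
  jointCount-symmetry i j = begin
    jointCount x y (toList T) (toList B) (b (toList T) (toList B)) (ℓ (toList T) (toList B)) i j
      ≡⟨ count-words _ (inPTB? x y (toList T) (toList B)) (x + y)
           -- For `d = N` the top contacts are `ℓ` and the bottom contacts `b`, the reverse of the
           -- order in the claim; hence the swap and the arguments `j`, `i`.
           (λ w → Indicator-map (λ (w∈𝒫 , top , bottom) → w∈𝒫 , bottom , top)
                                (λ (w∈𝒫 , bottom , top) → w∈𝒫 , top , bottom)
                                (term-indicator N j i w)) ⟩
    ∑ (x + y) (term N T B j i)  ≡⟨ W-∑ N T B j i ⟨
    W N T B j i                 ≡⟨ exchange (x + y) T~B j i ⟩
    W E T B i j                 ≡⟨ W-∑ E T B i j ⟩
    ∑ (x + y) (term E T B i j)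
      ≡⟨ count-words _ (inPTB? x y (toList T) (toList B)) (x + y) (term-indicator E i j) ⟨
    jointCount x y (toList T) (toList B) (t (toList T) (toList B)) (r (toList T) (toList B)) i j ∎
    where
    open ≡-Reasoning
    T~B : north T ≡ north B
    T~B = trans (endpoint⇒countN (toList T) T-end) (sym (endpoint⇒countN (toList B) B-end))

toList-surjective : (P : Path) → length P ≡ n → ∃ λ (v : Vec Step n) → toList v ≡ P
toList-surjective P refl = fromList P , toList∘fromList P

theorem2p2 : (x y : ℕ) (T B : Path) →
    endpoint T ≡ (x , y) → endpoint B ≡ (x , y) → WeaklyAbove T B →
    (i j : ℕ) →
    jointCount x y T B (b T B) (ℓ T B) i j ≡ jointCount x y T B (t T B) (r T B) i j
theorem2p2 x y T B T-end B-end _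
  with toList-surjective T (endpoint⇒length T T-end) | toList-surjective B (endpoint⇒length B B-end)
... | _ , refl | _ , refl = jointCount-symmetry T-end B-end
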